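{- Let $t\ge1$ and let $D$ be an arbitrary fixed set of $t$ positive integers. Set $D_0=\{2,4,\dots,2t\}$. Then for all sufficiently large $n$ (depending on $D$), $$A(n,D)\le A(n,D_0)=\sum_{i=0}^{t}\binom{n-1}{i}.$$ Furthermore, if $D$ contains at least one odd integer, then for all sufficiently large $n$ $$A(n,D)\le 2\sum_{i=0}^{t-1}\binom{n-1}{i},$$ where the right-hand side is $o(n^t)$ as $n\to\infty$, whereas $A(n,D_0)\sim\frac{1}{t!}n^t$ as $n\to\infty$.
   Context: For a set $D$ of positive integers, $A(n,D)$ denotes the maximum size of a family $\mathcal F\subseteq 2^{[n]}$ of subsets of $[n]=\{1,\dots,n\}$ such that $|A\triangle B|\in D$ for all distinct $A,B\in\mathcal F$, where $\triangle$ denotes symmetric difference. -}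

module Defs where

open import Data.Bool.Base using (true; false)
open import Data.Bool.Properties using () renaming (_≟_ to _≟ᴮ_)
open import Data.Empty using (⊥)
open import Data.Fin.Subset using (Subset; _∪_; _─_; ∣_∣)
import Data.Integer.Base as ℤ
open import Data.List.Base using (List; []; _∷_; _++_; map; filter; length; applyUpTo)
open import Data.List.Extrema.Nat using (max; xs≤max; argmax-sel)
open import Data.List.Membership.Propositional using (_∈_)
open import Data.List.Membership.Propositional.Properties
  using (∈-map⁺; ∈-map⁻; ∈-filter⁺; ∈-filter⁻; ∈-++⁺ˡ; ∈-++⁺ʳ)
open import Data.List.Membership.Propositional.Properties.WithK using (unique∧set⇒bag)
import Data.List.Membership.DecPropositional as DecMembership
open import Data.List.Relation.Binary.BagAndSetEquality using (∼bag⇒↭)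
open import Data.List.Relation.Binary.Permutation.Propositional.Properties using (↭-length)
open import Data.List.Relation.Unary.All as All using (All; []; _∷_; all?)
open import Data.List.Relation.Unary.AllPairs using ([]; _∷_)
open import Data.List.Relation.Unary.Any using (here; there)
open import Data.List.Relation.Unary.Unique.Propositional using (Unique)
import Data.List.Relation.Unary.Unique.Propositional.Properties as Unique
import Data.List.Relation.Unary.Unique.DecPropositional as DecUnique
open import Data.Nat.Base as ℕ using (ℕ; zero; suc)
import Data.Nat.Properties as ℕ
open import Data.Product.Base using (∃; _×_; _,_; proj₁; proj₂)
open import Data.Rational.Base as ℚ using (ℚ; 0ℚ; _/_)
open import Data.Sum.Base using (inj₁; inj₂)
open import Data.Vec.Base using ([]; _∷_)
open import Data.Vec.Properties using (≡-dec; ∷-injectiveʳ)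
open import Function.Base using (id; _∘_)
open import Function.Bundles using (mk⇔)
open import Relation.Binary.Definitions using (DecidableEquality)
open import Relation.Binary.PropositionalEquality
  using (_≡_; _≢_; refl; sym; subst)
open import Relation.Nullary.Decidable using (yes; no; ¬?; _×-dec_; _→-dec_)
open import Relation.Unary using (Pred; Decidable)

infixl 5 _△_

_△_ : ∀ {n} → Subset n → Subset n → Subset n
p △ q = (p ─ q) ∪ (q ─ p)

-- The ground set [n] is Fin n; finite sets of subsets (and of naturals) are
-- duplicate-free lists.
HasDistancesIn : ∀ {n} → List ℕ → List (Subset n) → Set
HasDistancesIn D F =
  Unique F × All (λ p → All (λ q → p ≢ q → ∣ p △ q ∣ ∈ D) F) F

_≟_ : ∀ {n} → DecidableEquality (Subset n)
_≟_ = ≡-dec _≟ᴮ_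

hasDistancesIn? : ∀ {n} (D : List ℕ) → Decidable (HasDistancesIn {n} D)
hasDistancesIn? D F =
  DecUnique.unique? _≟_ F ×-dec
  all? (λ p → all? (λ q → ¬? (p ≟ q) →-dec DecMembership._∈?_ ℕ._≟_ ∣ p △ q ∣ D) F) F

allSubsets : ∀ n → List (Subset n)
allSubsets zero    = [] ∷ []
allSubsets (suc n) = map (true ∷_) (allSubsets n) ++ map (false ∷_) (allSubsets n)

sublists : ∀ {a} {X : Set a} → List X → List (List X)
sublists []       = [] ∷ []
sublists (x ∷ xs) = map (x ∷_) (sublists xs) ++ sublists xs

-- Each family on [n] occurs, up to reordering, among the sublists of
-- `allSubsets n`.  `A-attained` and `A-upper` show that this is the maximum
-- over all families.
A : ℕ → List ℕ → ℕ
A n D = max 0 (map length (filter (hasDistancesIn? D) (sublists (allSubsets n))))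

∈-allSubsets : ∀ {n} (p : Subset n) → p ∈ allSubsets n
∈-allSubsets []          = here refl
∈-allSubsets (true  ∷ p) = ∈-++⁺ˡ (∈-map⁺ (true ∷_) (∈-allSubsets p))
∈-allSubsets (false ∷ p) =
  ∈-++⁺ʳ (map (true ∷_) (allSubsets _)) (∈-map⁺ (false ∷_) (∈-allSubsets p))

allSubsets-unique : ∀ n → Unique (allSubsets n)
allSubsets-unique zero    = [] ∷ []
allSubsets-unique (suc n) =
  Unique.++⁺ (Unique.map⁺ ∷-injectiveʳ (allSubsets-unique n))
             (Unique.map⁺ ∷-injectiveʳ (allSubsets-unique n))
             λ { (p∈ , p∈′) → disjoint (∈-map⁻ (true ∷_) p∈) (∈-map⁻ (false ∷_) p∈′) }
  where
  disjoint : ∀ {p : Subset (suc n)} →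
             ∃ (λ q → q ∈ allSubsets n × p ≡ true ∷ q) →
             ∃ (λ q → q ∈ allSubsets n × p ≡ false ∷ q) → ⊥
  disjoint (_ , _ , refl) (_ , _ , ())

filter∈sublists : ∀ {a p} {X : Set a} {P : Pred X p} (P? : Decidable P) xs →
                  filter P? xs ∈ sublists xs
filter∈sublists P? []       = here refl
filter∈sublists P? (x ∷ xs) with P? x
... | yes _ = ∈-++⁺ˡ (∈-map⁺ (x ∷_) (filter∈sublists P? xs))
... | no  _ = ∈-++⁺ʳ (map (x ∷_) (sublists xs)) (filter∈sublists P? xs)

A-attained : ∀ n D → ∃ λ (F : List (Subset n)) → HasDistancesIn D F × length F ≡ A n D
A-attained n D
  with argmax-sel id 0 (map length (filter (hasDistancesIn? D) (sublists (allSubsets n))))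
... | inj₁ A≡0 = [] , ([] , []) , sym A≡0
... | inj₂ A∈  with ∈-map⁻ length A∈
...   | F , F∈ , A≡∣F∣ =
  F , proj₂ (∈-filter⁻ (hasDistancesIn? D) {xs = sublists (allSubsets n)} F∈) , sym A≡∣F∣

A-upper : ∀ n D (F : List (Subset n)) → HasDistancesIn D F → length F ℕ.≤ A n D
A-upper n D F (F! , dist) = subst (ℕ._≤ A n D) ∣G∣≡∣F∣
  (All.lookup (xs≤max 0 (map length (filter (hasDistancesIn? D) (sublists (allSubsets n)))))
    (∈-map⁺ length (∈-filter⁺ (hasDistancesIn? D)
      (filter∈sublists (_∈? F) (allSubsets n)) (G! , distG))))
  where
  open DecMembership _≟_ using (_∈?_)

  G : List (Subset n)
  G = filter (_∈? F) (allSubsets n)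

  G⊆F : ∀ {p} → p ∈ G → p ∈ F
  G⊆F p∈G = proj₂ (∈-filter⁻ (_∈? F) {xs = allSubsets n} p∈G)

  G! : Unique G
  G! = Unique.filter⁺ (_∈? F) (allSubsets-unique n)

  distG : All (λ p → All (λ q → p ≢ q → ∣ p △ q ∣ ∈ D) G) G
  distG = All.tabulate λ p∈G → All.tabulate λ q∈G →
    All.lookup (All.lookup dist (G⊆F p∈G)) (G⊆F q∈G)

  ∣G∣≡∣F∣ : length G ≡ length F
  ∣G∣≡∣F∣ = ↭-length (∼bag⇒↭ (unique∧set⇒bag G! F!
    (mk⇔ G⊆F λ p∈F → ∈-filter⁺ (_∈? F) (∈-allSubsets _) p∈F)))

D₀ : ℕ → List ℕ
D₀ t = applyUpTo (λ i → 2 ℕ.* suc i) t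

Eventually : (ℕ → Set) → Set
Eventually P = ∃ λ N → ∀ n → n ℕ.≥ N → P n

infix 4 _=o_ _~_

_=o_ : (ℕ → ℚ) → (ℕ → ℚ) → Set
f =o g = ∀ ε → 0ℚ ℚ.< ε → Eventually λ n → ℚ.∣ f n ∣ ℚ.≤ ε ℚ.* ℚ.∣ g n ∣

-- For g eventually nonzero, this says f n / g n → 1.
_~_ : (ℕ → ℚ) → (ℕ → ℚ) → Set
f ~ g = (λ n → f n ℚ.- g n) =o g

fromℕ : ℕ → ℚ
fromℕ n = ℤ.+ n / 1

{-# OPTIONS --safe #-}
-- Let F have all distances in D, |D| = t, and let K(p, q) = Σᵢ χᵢ(p) χᵢ(q)
-- = n - 2|p △ q|, where χ_S(p) = (-1)^|S ∩ p|.  The kernel ∏_{d ∈ D} (K - (n - 2d))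
-- is diagonal and positive on F.  Since K χ_S ⊗ χ_S is the sum of the
-- χ_{S △ i} ⊗ χ_{S △ i}, the kernel expands into terms χ_S ⊗ χ_S with |S| ≤ t
-- whose coefficients have sign (-1)^(t - |S|) once n ≥ 2 max D.  If F had more
-- members than there are sets S with |S| ≤ t and |S| ≡ t (mod 2), some nonzero
-- combination of its members would be orthogonal to all those χ_S, making the
-- quadratic form of the kernel ≤ 0 there.  These sets S number
-- Σ_{i ≤ t} C(n-1, i), and form an extremal family for D₀.  An odd distance
-- only occurs between sets of different size parity, so splitting F by parity
-- gives two families with at most t - 1 distances each.
module Submission where

open import Defs
open import Algebra.Bundles using (CommutativeMonoid)
import Algebra.Properties.AbelianGroup as AbelianGroup
import Algebra.Properties.CommutativeSemigroup as CommutativeSemigroup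
open import Data.Bool.Base using (Bool; true; false; not; if_then_else_)
open import Data.Fin.Base using (Fin; zero; suc; punchIn)
open import Data.Fin.Properties using (all?; ¬∀⟶∃¬; punchInᵢ≢i)
import Data.Integer.Base as ℤ
import Data.Integer.Properties as ℤ
open import Data.List.Base as List using (List; []; _∷_; _++_; length; map; upTo; filter)
open import Data.List.Extrema.Nat using (max; xs≤max)
open import Data.List.Membership.Propositional using (_∈_)
open import Data.List.Membership.Propositional.Properties
  using (∈-map⁺; ∈-map⁻; ∈-++⁺ˡ; ∈-++⁺ʳ; ∈-++⁻; ∈-lookup; ∈-applyUpTo⁺; ∈-filter⁺; ∈-filter⁻)
open import Data.List.Properties
  using (length-map; length-++; map-++; upTo-∷ʳ; filter-notAll; length-applyUpTo)
open import Data.List.Relation.Unary.All as All using (All; []; _∷_)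
import Data.List.Relation.Unary.All.Properties as All
open import Data.List.Relation.Unary.AllPairs using ([]; _∷_)
open import Data.List.Relation.Unary.Any using (Any; here; there)
open import Data.List.Relation.Unary.Unique.Propositional using (Unique)
import Data.List.Relation.Unary.Unique.Propositional.Properties as Unique
open import Data.Nat.Base as ℕ using (ℕ; zero; suc; z≤n; s≤s; _∸_; _⊔_)
import Data.Nat.Properties as ℕ
open import Data.Product.Base using (∃; _×_; _,_; proj₁; proj₂)
open import Data.Rational.Base as ℚ using (ℚ; mkℚ; 0ℚ; 1ℚ; toℚᵘ; ↧ₙ_; _/_)
import Data.Rational.Properties as ℚ
open import Data.Rational.Unnormalised.Base as ℚᵘ using (mkℚᵘ; *≡*; *≤*)
import Data.Rational.Unnormalised.Properties as ℚᵘ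
open import Data.Sum.Base as Sum using (_⊎_; inj₁; inj₂; [_,_]′)
open import Data.Vec.Base using ([]; _∷_; lookup; updateAt)
open import Data.Vec.Functional using (insertAt)
open import Data.Vec.Functional.Properties using (insertAt-lookup; insertAt-punchIn)
open import Data.Vec.Properties using (∷-injectiveʳ)
open import Function.Base using (_∘_)
open import Relation.Binary.PropositionalEquality
open import Relation.Nullary.Decidable using (Dec; yes; no; ¬?)
open import Relation.Nullary.Negation using (¬_; contradiction)
open import Relation.Unary using (Pred; Decidable)

-- Asymptotic comparison of integer sequences

module _ where
  open import Data.Rational.Base
    using (_+_; _*_; _-_; -_; _≤_; _<_; ∣_∣; Positive; positive; NonNegative; nonNegative)

  private
    module *ℚ = CommutativeSemigroup (CommutativeMonoid.commutativeSemigroup ℚ.*-1-commutativeMonoid)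
    module +ℚ = AbelianGroup ℚ.+-0-abelianGroup

  toℚᵘ-fromℕ : ∀ n → toℚᵘ (fromℕ n) ℚᵘ.≃ mkℚᵘ (ℤ.+ n) 0
  toℚᵘ-fromℕ n = ℚ.toℚᵘ-fromℚᵘ (mkℚᵘ (ℤ.+ n) 0)

  fromℕ-+ : ∀ m n → fromℕ (m ℕ.+ n) ≡ fromℕ m + fromℕ n
  fromℕ-+ m n = ℚ.toℚᵘ-injective (begin
    toℚᵘ (fromℕ (m ℕ.+ n))                    ≈⟨ toℚᵘ-fromℕ (m ℕ.+ n) ⟩
    mkℚᵘ (ℤ.+ (m ℕ.+ n)) 0                    ≈⟨ *≡* (cong (ℤ._* ℤ.1ℤ) (sym
                                                   (cong₂ ℤ._+_ (ℤ.*-identityʳ (ℤ.+ m)) (ℤ.*-identityʳ (ℤ.+ n))))) ⟩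
    mkℚᵘ (ℤ.+ m) 0 ℚᵘ.+ mkℚᵘ (ℤ.+ n) 0        ≈⟨ ℚᵘ.+-cong (toℚᵘ-fromℕ m) (toℚᵘ-fromℕ n) ⟨
    toℚᵘ (fromℕ m) ℚᵘ.+ toℚᵘ (fromℕ n)        ≈⟨ ℚ.toℚᵘ-homo-+ (fromℕ m) (fromℕ n) ⟨
    toℚᵘ (fromℕ m + fromℕ n)                  ∎)
    where open ℚᵘ.≃-Reasoning

  fromℕ-* : ∀ m n → fromℕ (m ℕ.* n) ≡ fromℕ m * fromℕ n
  fromℕ-* m n = ℚ.toℚᵘ-injective (begin
    toℚᵘ (fromℕ (m ℕ.* n))                    ≈⟨ toℚᵘ-fromℕ (m ℕ.* n) ⟩
    mkℚᵘ (ℤ.+ (m ℕ.* n)) 0                    ≈⟨ *≡* (cong (ℤ._* ℤ.1ℤ) (ℤ.pos-* m n)) ⟩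
    mkℚᵘ (ℤ.+ m) 0 ℚᵘ.* mkℚᵘ (ℤ.+ n) 0        ≈⟨ ℚᵘ.*-cong (toℚᵘ-fromℕ m) (toℚᵘ-fromℕ n) ⟨
    toℚᵘ (fromℕ m) ℚᵘ.* toℚᵘ (fromℕ n)        ≈⟨ ℚ.toℚᵘ-homo-* (fromℕ m) (fromℕ n) ⟨
    toℚᵘ (fromℕ m * fromℕ n)                  ∎)
    where open ℚᵘ.≃-Reasoning

  fromℕ-mono : ∀ {m n} → m ℕ.≤ n → fromℕ m ≤ fromℕ n
  fromℕ-mono {m} {n} m≤n = ℚ.toℚᵘ-cancel-≤ (begin
    toℚᵘ (fromℕ m)  ≃⟨ toℚᵘ-fromℕ m ⟩
    mkℚᵘ (ℤ.+ m) 0  ≤⟨ *≤* (ℤ.*-monoʳ-≤-nonNeg ℤ.1ℤ (ℤ.+≤+ m≤n)) ⟩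
    mkℚᵘ (ℤ.+ n) 0  ≃⟨ toℚᵘ-fromℕ n ⟨
    toℚᵘ (fromℕ n)  ∎)
    where open ℚᵘ.≤-Reasoning

  0≤fromℕ : ∀ n → 0ℚ ≤ fromℕ n
  0≤fromℕ n = fromℕ-mono {0} {n} ℕ.z≤n

  fromℕ-pos : ∀ n → Positive (fromℕ (suc n))
  fromℕ-pos n = ℚ.normalize-pos (suc n) 1

  ∣fromℕ∣ : ∀ n → ∣ fromℕ n ∣ ≡ fromℕ n
  ∣fromℕ∣ n = ℚ.0≤p⇒∣p∣≡p (0≤fromℕ n)

  p*↧p≡↥p : ∀ p → p * fromℕ (↧ₙ p) ≡ ℚ.↥ p / 1
  p*↧p≡↥p p@(mkℚ n d-1 _) = ℚ.toℚᵘ-injective (begin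
    toℚᵘ (p * fromℕ (suc d-1))            ≈⟨ ℚ.toℚᵘ-homo-* p (fromℕ (suc d-1)) ⟩
    toℚᵘ p ℚᵘ.* toℚᵘ (fromℕ (suc d-1))    ≈⟨ ℚᵘ.*-congˡ {toℚᵘ p} (toℚᵘ-fromℕ (suc d-1)) ⟩
    toℚᵘ p ℚᵘ.* mkℚᵘ (ℤ.+ suc d-1) 0      ≈⟨ *≡* cross ⟩
    mkℚᵘ n 0                              ≈⟨ ℚ.toℚᵘ-fromℚᵘ (mkℚᵘ n 0) ⟨
    toℚᵘ (n / 1)                          ∎)
    where
    open ℚᵘ.≃-Reasoning
    cross : n ℤ.* ℤ.+ suc d-1 ℤ.* ℤ.1ℤ ≡ n ℤ.* (ℤ.+ (suc d-1 ℕ.* 1))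
    cross = trans (ℤ.*-identityʳ _) (cong (λ k → n ℤ.* ℤ.+ k) (sym (ℕ.*-identityʳ (suc d-1))))

  -- For ε = (n+1)/d the witness `d * c` clears the denominator: ε times it is (n+1)c, which is at
  -- least `c`.
  archimedean : ∀ ε → 0ℚ < ε → ∀ c → ∃ λ N → fromℕ c ≤ ε * fromℕ N
  archimedean (mkℚ ℤ.-[1+ n ] d-1 _) (ℚ.*<* ())
  archimedean (mkℚ (ℤ.+ zero) d-1 _) (ℚ.*<* (ℤ.+<+ ()))
  archimedean ε@(mkℚ (ℤ.+ suc n) d-1 _) _ c = suc d-1 ℕ.* c , (begin
    fromℕ c                                  ≤⟨ fromℕ-mono (ℕ.m≤n*m c (suc n)) ⟩
    fromℕ (suc n ℕ.* c)                      ≡⟨ fromℕ-* (suc n) c ⟩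
    fromℕ (suc n) * fromℕ c                  ≡⟨ cong (_* fromℕ c) (p*↧p≡↥p ε) ⟨
    ε * fromℕ (suc d-1) * fromℕ c            ≡⟨ ℚ.*-assoc ε (fromℕ (suc d-1)) (fromℕ c) ⟩
    ε * (fromℕ (suc d-1) * fromℕ c)          ≡⟨ cong (ε *_) (fromℕ-* (suc d-1) c) ⟨
    ε * fromℕ (suc d-1 ℕ.* c)                ∎)
    where open ℚ.≤-Reasoning

  -- Every asymptotic claim here has relative error of order 1/n, so one inequality with a fixed `c`
  -- replaces a separate argument for each ε.
  n∣f∣≤c∣g∣⇒f=og : ∀ {f g} c → Eventually (λ n → fromℕ n * ∣ f n ∣ ≤ fromℕ c * ∣ g n ∣) → f =o g
  -- `M` secures `c ≤ ε * n`; the `suc` makes `n` positive, so that it can be cancelled.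
  n∣f∣≤c∣g∣⇒f=og {f} {g} c (N , bound) ε 0<ε = suc (N ⊔ M) , estimate
    where
    open ℚ.≤-Reasoning
    M = proj₁ (archimedean ε 0<ε c)
    estimate : ∀ n → n ℕ.≥ suc (N ⊔ M) → ∣ f n ∣ ≤ ε * ∣ g n ∣
    estimate n@(suc n-1) n>N⊔M = ℚ.*-cancelˡ-≤-pos (fromℕ n) {{fromℕ-pos n-1}} (begin
      fromℕ n * ∣ f n ∣        ≤⟨ bound n (ℕ.≤-trans (ℕ.m≤m⊔n N M) (ℕ.<⇒≤ n>N⊔M)) ⟩
      fromℕ c * ∣ g n ∣        ≤⟨ ℚ.*-monoʳ-≤-nonNeg ∣ g n ∣ {{ℚ.∣-∣-nonNeg (g n)}} c≤εn ⟩
      ε * fromℕ n * ∣ g n ∣    ≡⟨ *ℚ.xy∙z≈y∙xz ε (fromℕ n) ∣ g n ∣ ⟩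
      fromℕ n * (ε * ∣ g n ∣)  ∎)
      where
      c≤εn : fromℕ c ≤ ε * fromℕ n
      c≤εn = ℚ.≤-trans (proj₂ (archimedean ε 0<ε c))
        (ℚ.*-monoˡ-≤-nonNeg ε {{ℚ.pos⇒nonNeg ε {{positive 0<ε}}}}
          (fromℕ-mono (ℕ.≤-trans (ℕ.m≤n⊔m N M) (ℕ.<⇒≤ n>N⊔M))))

  p≤q+r⇒p-q≤r : ∀ {p q r} → p ≤ q + r → p - q ≤ r
  p≤q+r⇒p-q≤r {p} {q} {r} p≤q+r = begin
    p - q        ≤⟨ ℚ.+-monoˡ-≤ (- q) p≤q+r ⟩
    q + r - q    ≡⟨ cong (_- q) (ℚ.+-comm q r) ⟩
    r + q - q    ≡⟨ ℚ.+-assoc r q (- q) ⟩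
    r + (q - q)  ≡⟨ cong (λ z → r + z) (ℚ.+-inverseʳ q) ⟩
    r + 0ℚ       ≡⟨ ℚ.+-identityʳ r ⟩
    r            ∎
    where open ℚ.≤-Reasoning

  n*[p-q]≤r : ∀ n p q r → n ℕ.* p ℕ.≤ n ℕ.* q ℕ.+ r → fromℕ n * (fromℕ p - fromℕ q) ≤ fromℕ r
  n*[p-q]≤r n p q r np≤nq+r = begin
    fromℕ n * (fromℕ p - fromℕ q)
      ≡⟨ ℚ.*-distribˡ-+ (fromℕ n) (fromℕ p) (- fromℕ q) ⟩
    fromℕ n * fromℕ p + fromℕ n * - fromℕ q
      ≡⟨ cong₂ _+_ (fromℕ-* n p) (trans (cong -_ (fromℕ-* n q)) (ℚ.neg-distribʳ-* (fromℕ n) (fromℕ q))) ⟨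
    fromℕ (n ℕ.* p) - fromℕ (n ℕ.* q)
      ≤⟨ p≤q+r⇒p-q≤r (subst (fromℕ (n ℕ.* p) ≤_) (fromℕ-+ (n ℕ.* q) r) (fromℕ-mono np≤nq+r)) ⟩
    fromℕ r ∎
    where open ℚ.≤-Reasoning

  -- Closeness is stated as two inequalities of naturals with the error added on the right, which
  -- avoids truncated subtraction; the sign of the difference selects the one that applies.
  n∣p-q∣≤r : ∀ n p q r → n ℕ.* p ℕ.≤ n ℕ.* q ℕ.+ r → n ℕ.* q ℕ.≤ n ℕ.* p ℕ.+ r →
             fromℕ n * ∣ fromℕ p - fromℕ q ∣ ≤ fromℕ r
  n∣p-q∣≤r n p q r np≤ nq≤ with ℚ.∣p∣≡p∨∣p∣≡-p (fromℕ p - fromℕ q)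
  ... | inj₁ eq = subst (λ z → fromℕ n * z ≤ fromℕ r) (sym eq) (n*[p-q]≤r n p q r np≤)
  ... | inj₂ eq = subst (λ z → fromℕ n * z ≤ fromℕ r)
    (sym (trans eq (+ℚ.⁻¹-anti-homo‿- (fromℕ p) (fromℕ q)))) (n*[p-q]≤r n q p r nq≤)

  fromℕ-=o : ∀ (f g : ℕ → ℕ) c → Eventually (λ n → n ℕ.* f n ℕ.≤ c ℕ.* g n) →
             (λ n → fromℕ (f n)) =o (λ n → fromℕ (g n))
  fromℕ-=o f g c (N , bound) = n∣f∣≤c∣g∣⇒f=og c (N , λ n n≥N → begin
    fromℕ n * ∣ fromℕ (f n) ∣ ≡⟨ cong (fromℕ n *_) (∣fromℕ∣ (f n)) ⟩
    fromℕ n * fromℕ (f n)     ≡⟨ fromℕ-* n (f n) ⟨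
    fromℕ (n ℕ.* f n)         ≤⟨ fromℕ-mono (bound n n≥N) ⟩
    fromℕ (c ℕ.* g n)         ≡⟨ fromℕ-* c (g n) ⟩
    fromℕ c * fromℕ (g n)     ≡⟨ cong (fromℕ c *_) (∣fromℕ∣ (g n)) ⟨
    fromℕ c * ∣ fromℕ (g n) ∣ ∎)
    where open ℚ.≤-Reasoning

  1/k*k≡1 : ∀ k .{{_ : ℕ.NonZero k}} → (ℤ.+ 1) / k * fromℕ k ≡ 1ℚ
  1/k*k≡1 k@(suc k-1) = ℚ.toℚᵘ-injective (begin
    toℚᵘ ((ℤ.+ 1) / k * fromℕ k)              ≈⟨ ℚ.toℚᵘ-homo-* ((ℤ.+ 1) / k) (fromℕ k) ⟩
    toℚᵘ ((ℤ.+ 1) / k) ℚᵘ.* toℚᵘ (fromℕ k)    ≈⟨ ℚᵘ.*-cong (ℚ.toℚᵘ-fromℚᵘ (mkℚᵘ (ℤ.+ 1) k-1)) (toℚᵘ-fromℕ k) ⟩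
    mkℚᵘ (ℤ.+ 1) k-1 ℚᵘ.* mkℚᵘ (ℤ.+ k) 0      ≈⟨ *≡* (ℤ.*-assoc (ℤ.+ 1) (ℤ.+ k) ℤ.1ℤ) ⟩
    mkℚᵘ (ℤ.+ 1) 0                            ∎)
    where open ℚᵘ.≃-Reasoning

  -- Since f - g/k = (1/k)(k f - g), it suffices to compare `k * f` with `g` over the naturals; the
  -- factor 1/k scales the difference and the error bound alike.
  fromℕ-~ : ∀ (f g : ℕ → ℕ) k .{{_ : ℕ.NonZero k}} c →
    Eventually (λ n → n ℕ.* (k ℕ.* f n) ℕ.≤ n ℕ.* g n ℕ.+ c ℕ.* g n ×
                      n ℕ.* g n ℕ.≤ n ℕ.* (k ℕ.* f n) ℕ.+ c ℕ.* g n) →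
    (λ n → fromℕ (f n)) ~ (λ n → (ℤ.+ 1) / k * fromℕ (g n))
  fromℕ-~ f g k c (N , bounds) = n∣f∣≤c∣g∣⇒f=og c (N , λ n n≥N → begin
    fromℕ n * ∣ fromℕ (f n) - r * fromℕ (g n) ∣
      ≡⟨ cong (λ z → fromℕ n * ∣ z ∣) (factor (f n) (fromℕ (g n))) ⟩
    fromℕ n * ∣ r * (fromℕ (k ℕ.* f n) - fromℕ (g n)) ∣
      ≡⟨ cong (fromℕ n *_) (∣r*∣ (fromℕ (k ℕ.* f n) - fromℕ (g n))) ⟩
    fromℕ n * (r * ∣ fromℕ (k ℕ.* f n) - fromℕ (g n) ∣)
      ≡⟨ *ℚ.x∙yz≈y∙xz (fromℕ n) r _ ⟩
    r * (fromℕ n * ∣ fromℕ (k ℕ.* f n) - fromℕ (g n) ∣)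
      ≤⟨ ℚ.*-monoˡ-≤-nonNeg r {{r≥0}} (n∣p-q∣≤r n (k ℕ.* f n) (g n) (c ℕ.* g n)
           (proj₁ (bounds n n≥N)) (proj₂ (bounds n n≥N))) ⟩
    r * fromℕ (c ℕ.* g n)
      ≡⟨ cong (r *_) (fromℕ-* c (g n)) ⟩
    r * (fromℕ c * fromℕ (g n))
      ≡⟨ *ℚ.x∙yz≈y∙xz r (fromℕ c) (fromℕ (g n)) ⟩
    fromℕ c * (r * fromℕ (g n))
      ≡⟨ cong (λ z → fromℕ c * (r * z)) (∣fromℕ∣ (g n)) ⟨
    fromℕ c * (r * ∣ fromℕ (g n) ∣)
      ≡⟨ cong (fromℕ c *_) (∣r*∣ (fromℕ (g n))) ⟨
    fromℕ c * ∣ r * fromℕ (g n) ∣ ∎)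
    where
    open ℚ.≤-Reasoning
    r = (ℤ.+ 1) / k
    r≥0 : NonNegative r
    r≥0 = ℚ.normalize-nonNeg 1 k
    ∣r*∣ : ∀ p → ∣ r * p ∣ ≡ r * ∣ p ∣
    ∣r*∣ p = trans (ℚ.∣p*q∣≡∣p∣*∣q∣ r p) (cong (_* ∣ p ∣) (ℚ.0≤p⇒∣p∣≡p (ℚ.nonNegative⁻¹ r {{r≥0}})))
    factor : ∀ a q → fromℕ a - r * q ≡ r * (fromℕ (k ℕ.* a) - q)
    factor a q = sym (begin-equality
      r * (fromℕ (k ℕ.* a) - q)            ≡⟨ ℚ.*-distribˡ-+ r (fromℕ (k ℕ.* a)) (- q) ⟩
      r * fromℕ (k ℕ.* a) + r * - q        ≡⟨ cong₂ _+_ (cong (r *_) (sym (fromℕ-* k a))) (ℚ.neg-distribʳ-* r q) ⟨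
      r * (fromℕ k * fromℕ a) - r * q      ≡⟨ cong (_- r * q) (ℚ.*-assoc r (fromℕ k) (fromℕ a)) ⟨
      r * fromℕ k * fromℕ a - r * q        ≡⟨ cong (λ z → z * fromℕ a - r * q) (1/k*k≡1 k) ⟩
      1ℚ * fromℕ a - r * q                 ≡⟨ cong (_- r * q) (ℚ.*-identityˡ (fromℕ a)) ⟩
      fromℕ a - r * q                      ∎)

open import Data.Fin.Subset using (Subset; ∣_∣; _∩_; ⊥)
open import Data.Fin.Subset.Properties using (∣⊥∣≡0)

module _ where
  open import Data.Integer.Base
    using (ℤ; +_; -[1+_]; _+_; _*_; _-_; -_; 0ℤ; 1ℤ; -1ℤ; _≤_; _<_; +≤+; +<+; positive; nonNegative)
  open import Algebra.Properties.Semiring.Sum ℤ.+-*-semiring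
    using (sum; ∑-distrib-+; *-distribˡ-sum; *-distribʳ-sum; sum-remove; sum-cong-≗;
           sum-replicate-zero; sum-syntax)
  open import Data.Integer.Tactic.RingSolver using (solve-∀)

  -- Linear systems over ℤ

  sum-zero : ∀ {m} {f : Fin m → ℤ} → (∀ i → f i ≡ 0ℤ) → sum f ≡ 0ℤ
  sum-zero {m} f≗0 = trans (sum-cong-≗ f≗0) (sum-replicate-zero m)

  Solvable : ∀ {m} → List (Fin m → ℤ) → Set
  Solvable {m} M = ∃ λ (u : Fin m → ℤ) → (∃ λ j → u j ≢ 0ℤ) ×
    All (λ r → ∑[ j < m ] (r j * u j) ≡ 0ℤ) M

  -- Fraction-free Gaussian elimination: cross-multiplying keeps the entries in ℤ. The pivot column,
  -- where the new row would be zero, is dropped.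
  eliminate : ∀ {m} → (Fin (suc m) → ℤ) → Fin (suc m) → (Fin (suc m) → ℤ) → Fin m → ℤ
  eliminate r p s j = r p * s (punchIn p j) - s p * r (punchIn p j)

  solvable-pivot : ∀ {m} (r : Fin (suc m) → ℤ) p → r p ≢ 0ℤ → (M : List (Fin (suc m) → ℤ)) →
                   Solvable (map (eliminate r p) M) → Solvable (r ∷ M)
  solvable-pivot {m} r p rₚ≢0 M (v , (j , vⱼ≢0) , Mv≡0) =
    u , (punchIn p j , uⱼ≢0) ,
    trans (dot r) rv≡0 ∷ All.map (λ {s} → trans (dot s)) (All.map⁻ Mv≡0)
    where
    partial : (Fin (suc m) → ℤ) → ℤ
    partial s = ∑[ i < m ] (s (punchIn p i) * v i)

    -- Back substitution would divide by `r p`; scaling all other unknowns by `r p` keeps the pivot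
    -- unknown integral.
    u : Fin (suc m) → ℤ
    u = insertAt (λ i → r p * v i) p (- partial r)

    uⱼ≢0 : u (punchIn p j) ≢ 0ℤ
    uⱼ≢0 uⱼ≡0 with ℤ.i*j≡0⇒i≡0∨j≡0 (r p) (trans (sym (insertAt-punchIn _ p _ j)) uⱼ≡0)
    ... | inj₁ rₚ≡0 = rₚ≢0 rₚ≡0
    ... | inj₂ vⱼ≡0 = vⱼ≢0 vⱼ≡0

    dot : ∀ s → ∑[ i < suc m ] (s i * u i) ≡ ∑[ i < m ] (eliminate r p s i * v i)
    dot s = begin
      ∑[ i < suc m ] (s i * u i)
        ≡⟨ sum-remove {i = p} (λ i → s i * u i) ⟩
      s p * u p + ∑[ i < m ] (s (punchIn p i) * u (punchIn p i))
        ≡⟨ cong₂ (λ x y → s p * x + y) (insertAt-lookup _ p _)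
             (trans (sum-cong-≗ (λ i → trans (cong (s (punchIn p i) *_) (insertAt-punchIn _ p _ i))
                      (swap (s (punchIn p i)) (r p) (v i))))
                    (sym (*-distribˡ-sum (r p) (λ i → s (punchIn p i) * v i)))) ⟩
      s p * - partial r + r p * partial s
        ≡⟨ rearrange (s p) (partial r) (r p * partial s) ⟩
      r p * partial s + (- s p) * partial r
        ≡⟨ cong₂ _+_ (*-distribˡ-sum (r p) (λ i → s (punchIn p i) * v i))
                     (*-distribˡ-sum (- s p) (λ i → r (punchIn p i) * v i)) ⟩
      ∑[ i < m ] (r p * (s (punchIn p i) * v i)) + ∑[ i < m ] (- s p * (r (punchIn p i) * v i))
        ≡⟨ ∑-distrib-+ (λ i → r p * (s (punchIn p i) * v i)) (λ i → - s p * (r (punchIn p i) * v i)) ⟨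
      ∑[ i < m ] (r p * (s (punchIn p i) * v i) + - s p * (r (punchIn p i) * v i))
        ≡⟨ sum-cong-≗ (λ i → factor (r p) (s (punchIn p i)) (v i) (s p) (r (punchIn p i))) ⟩
      ∑[ i < m ] (eliminate r p s i * v i) ∎
      where
      open ≡-Reasoning
      swap : ∀ a b c → a * (b * c) ≡ b * (a * c)
      swap = solve-∀
      rearrange : ∀ a b c → a * - b + c ≡ c + (- a) * b
      rearrange = solve-∀
      factor : ∀ a b c d e → a * (b * c) + - d * (e * c) ≡ (a * b - d * e) * c
      factor = solve-∀

    rv≡0 : ∑[ i < m ] (eliminate r p r i * v i) ≡ 0ℤ
    rv≡0 = sum-zero (λ i → cong (_* v i) (ℤ.+-inverseʳ (r p * r (punchIn p i))))

  underdetermined : ∀ {m} (M : List (Fin m → ℤ)) → length M ℕ.< m → Solvable M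
  underdetermined {suc m} []      _           = (λ _ → 1ℤ) , (zero , λ ()) , []
  underdetermined {suc m} (r ∷ M) (s≤s ∣M∣<m) =
    -- A zero row imposes nothing. Otherwise the pivot removes one equation and one unknown, so
    -- unknowns remain in excess.
    [ (λ r≗0 → let u , u≢0 , Mu≡0 = underdetermined M (ℕ.m<n⇒m<1+n ∣M∣<m) in
        u , u≢0 , sum-zero (λ j → cong (_* u j) (r≗0 j)) ∷ Mu≡0)
    , (λ (p , rₚ≢0) → solvable-pivot r p rₚ≢0 M (underdetermined (map (eliminate r p) M)
        (subst (ℕ._< m) (sym (length-map (eliminate r p) M)) ∣M∣<m)))
    ]′ (zero-or-pivot (all? (λ j → r j ℤ.≟ 0ℤ)))
    where
    zero-or-pivot : Dec (∀ j → r j ≡ 0ℤ) → (∀ j → r j ≡ 0ℤ) ⊎ ∃ λ p → r p ≢ 0ℤ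
    zero-or-pivot (yes r≗0) = inj₁ r≗0
    zero-or-pivot (no r≇0)  = inj₂ (¬∀⟶∃¬ _ _ (λ j → r j ℤ.≟ 0ℤ) r≇0)

  -- Characters and the distance kernel

  sign : Bool → ℤ
  sign b = if b then -1ℤ else 1ℤ

  -- The character p ↦ (-1)^∣S ∩ p∣.
  χ : ∀ {n} → Subset n → Subset n → ℤ
  χ []      []      = 1ℤ
  χ (s ∷ S) (b ∷ p) = (if s then sign b else 1ℤ) * χ S p

  toggle : ∀ {n} → Fin n → Subset n → Subset n
  toggle i S = updateAt S i not

  sign*sign : ∀ b (x : ℤ) → sign b * (sign b * x) ≡ x
  sign*sign true  x = trans (ℤ.-1*i≡-i _) (trans (cong -_ (ℤ.-1*i≡-i x)) (ℤ.neg-involutive x))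
  sign*sign false x = trans (ℤ.*-identityˡ _) (ℤ.*-identityˡ x)

  -- The character of a singleton squares to 1, so the same factor accounts for `i` entering `S` and
  -- for `i` leaving it.
  χ-toggle : ∀ {n} i (S p : Subset n) → χ (toggle i S) p ≡ sign (lookup p i) * χ S p
  χ-toggle zero    (true  ∷ S) (b ∷ p) = trans (ℤ.*-identityˡ _) (sym (sign*sign b _))
  χ-toggle zero    (false ∷ S) (b ∷ p) = cong (sign b *_) (sym (ℤ.*-identityˡ _))
  χ-toggle (suc i) (s ∷ S) (b ∷ p) =
    trans (cong ((if s then sign b else 1ℤ) *_) (χ-toggle i S p))
          (swap (if s then sign b else 1ℤ) (sign (lookup p i)) (χ S p))
    where
    swap : ∀ a b c → a * (b * c) ≡ b * (a * c)
    swap = solve-∀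

  ∣toggle∣ : ∀ {n} i (S : Subset n) →
             ∣ toggle i S ∣ ≡ suc ∣ S ∣ ⊎ suc ∣ toggle i S ∣ ≡ ∣ S ∣
  ∣toggle∣ zero    (true  ∷ S) = inj₂ refl
  ∣toggle∣ zero    (false ∷ S) = inj₁ refl
  ∣toggle∣ (suc i) (true  ∷ S) = Sum.map (cong suc) (cong suc) (∣toggle∣ i S)
  ∣toggle∣ (suc i) (false ∷ S) = ∣toggle∣ i S

  -- A coordinate contributes 1 where `p` and `q` agree and -1 where they differ.
  correlation : ∀ {n} → Subset n → Subset n → ℤ
  correlation {n} p q = ∑[ i < n ] (sign (lookup p i) * sign (lookup q i))

  correlation≡ : ∀ {n} (p q : Subset n) → correlation p q ≡ + n - + (2 ℕ.* ∣ p △ q ∣)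
  correlation≡ []      []      = refl
  correlation≡ {suc n} (b ∷ p) (c ∷ q) =
    trans (cong (λ z → sign b * sign c + z) (correlation≡ p q)) (step b c)
    where
    d = ∣ p △ q ∣
    agree : ∀ a e → 1ℤ + (a - e) ≡ (1ℤ + a) - e
    agree = solve-∀
    differ : ∀ a e → -1ℤ + (a - (e + e)) ≡ (1ℤ + a) - ((1ℤ + e) + (1ℤ + e))
    differ = solve-∀
    double : ∀ m → + (2 ℕ.* m) ≡ + m + + m
    double m = trans (cong (λ z → + (m ℕ.+ z)) (ℕ.+-identityʳ m)) (ℤ.pos-+ m m)
    differ′ : -1ℤ + (+ n - + (2 ℕ.* d)) ≡ + suc n - + (2 ℕ.* suc d)
    differ′ = trans (cong (λ z → -1ℤ + (+ n - z)) (double d))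
      (trans (differ (+ n) (+ d)) (cong (λ z → + suc n - z) (sym (double (suc d)))))
    step : ∀ b c → sign b * sign c + (+ n - + (2 ℕ.* d)) ≡
                   + suc n - + (2 ℕ.* ∣ (b ∷ p) △ (c ∷ q) ∣)
    step true  true  = agree (+ n) (+ (2 ℕ.* d))
    step true  false = differ′
    step false true  = differ′
    step false false = agree (+ n) (+ (2 ℕ.* d))

  -- Vanishes at distance d for every d in D, and is positive on the diagonal
  -- as long as n ≥ 2d > 0 (the subtraction n ∸ 2d is then not truncated).
  kernel : ∀ {n} → List ℕ → Subset n → Subset n → ℤ
  kernel         []      p q = 1ℤ
  kernel {n} (d ∷ D) p q = (correlation p q - + (n ∸ 2 ℕ.* d)) * kernel D p q

  -- "(-1)ᵏ z ≤ 0"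
  Alternating : ℕ → ℤ → Set
  Alternating zero    z = z ≤ 0ℤ
  Alternating (suc k) z = Alternating k (- z)

  alternating-0 : ∀ k → Alternating k 0ℤ
  alternating-0 zero    = ℤ.≤-refl
  alternating-0 (suc k) = alternating-0 k

  alternating-+ : ∀ k {y z} → Alternating k y → Alternating k z → Alternating k (y + z)
  alternating-+ zero    y≤0 z≤0 = ℤ.+-mono-≤ y≤0 z≤0
  alternating-+ (suc k) {y} {z} ay az =
    subst (Alternating k) (sym (ℤ.neg-distrib-+ y z)) (alternating-+ k ay az)

  alternating-* : ∀ k c {z} → Alternating k z → Alternating k (+ c * z)
  alternating-* zero    c {z} z≤0 =
    subst (λ y → + c * z ≤ y) (ℤ.*-zeroʳ (+ c)) (ℤ.*-monoˡ-≤-nonNeg (+ c) z≤0)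
  alternating-* (suc k) c {z} az =
    subst (Alternating k) (sym (ℤ.neg-distribʳ-* (+ c) z)) (alternating-* k c az)

  alternating-sum : ∀ k {m} (f : Fin m → ℤ) → (∀ i → Alternating k (f i)) → Alternating k (sum f)
  alternating-sum k {zero}  f af = alternating-0 k
  alternating-sum k {suc m} f af = alternating-+ k (af zero) (alternating-sum k (f ∘ suc) (af ∘ suc))

  alternating-2+ : ∀ k {z} → Alternating k z → Alternating (2 ℕ.+ k) z
  alternating-2+ k {z} = subst (Alternating k) (sym (ℤ.neg-involutive z))

  0≤z*z : ∀ z → 0ℤ ≤ z * z
  0≤z*z (+ n)      = subst (0ℤ ≤_) (ℤ.pos-* n n) (+≤+ ℕ.z≤n)
  0≤z*z -[1+ n ] = +≤+ ℕ.z≤n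

  -- For odd `k` this is nonnegativity of squares. For even `k` the sign condition forces `z` to
  -- vanish, and only then is the hypothesis called upon, with `j` half of `k`.
  alternating-square : ∀ k z → (∀ j → 2 ℕ.* j ≡ k → z ≡ 0ℤ) → Alternating k (z * z)
  alternating-square zero          z z≡0 = ℤ.≤-reflexive (cong (_* z) (z≡0 0 refl))
  alternating-square (suc zero)    z z≡0 = ℤ.neg-mono-≤ (0≤z*z z)
  alternating-square (suc (suc k)) z z≡0 = alternating-2+ k (alternating-square k z λ j 2j≡k →
    z≡0 (suc j) (trans (ℕ.*-suc 2 j) (cong (2 ℕ.+_) 2j≡k)))

  -- Quadratic forms of kernels on a family

  module QuadraticForm {n m : ℕ} (x : Fin m → Subset n) (u : Fin m → ℤ) where

    form : (Subset n → Subset n → ℤ) → ℤ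
    form k = ∑[ a < m ] ∑[ b < m ] (u a * u b * k (x a) (x b))

    form-cong : ∀ {k l} → (∀ p q → k p q ≡ l p q) → form k ≡ form l
    form-cong k≗l = sum-cong-≗ λ a → sum-cong-≗ λ b → cong (u a * u b *_) (k≗l (x a) (x b))

    form-+ : ∀ k l → form (λ p q → k p q + l p q) ≡ form k + form l
    form-+ k l = trans
      (sum-cong-≗ λ a → trans
        (sum-cong-≗ λ b → ℤ.*-distribˡ-+ (u a * u b) (k (x a) (x b)) (l (x a) (x b)))
        (∑-distrib-+ (λ b → u a * u b * k (x a) (x b)) (λ b → u a * u b * l (x a) (x b))))
      (∑-distrib-+ (λ a → ∑[ b < m ] (u a * u b * k (x a) (x b)))
                   (λ a → ∑[ b < m ] (u a * u b * l (x a) (x b))))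

    form-* : ∀ c k → form (λ p q → c * k p q) ≡ c * form k
    form-* c k = trans
      (sum-cong-≗ λ a → trans
        (sum-cong-≗ λ b → swap (u a * u b) c (k (x a) (x b)))
        (sym (*-distribˡ-sum c (λ b → u a * u b * k (x a) (x b)))))
      (sym (*-distribˡ-sum c (λ a → ∑[ b < m ] (u a * u b * k (x a) (x b)))))
      where
      swap : ∀ a b c → a * (b * c) ≡ b * (a * c)
      swap = solve-∀

    form-sum : ∀ {r} (k : Fin r → Subset n → Subset n → ℤ) →
               form (λ p q → ∑[ i < r ] k i p q) ≡ ∑[ i < r ] form (k i)
    form-sum {zero}  k = form-* 0ℤ (λ _ _ → 0ℤ)
    form-sum {suc r} k = trans (form-+ (k zero) (λ p q → ∑[ i < r ] k (suc i) p q))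
                               (cong (λ z → form (k zero) + z) (form-sum (k ∘ suc)))

    -- The kernel has rank one, so its form is the square of a linear form; this is where
    -- orthogonality of `u` to a character enters.
    form-χ : ∀ S → form (λ p q → χ S p * χ S q) ≡
             (∑[ a < m ] (χ S (x a) * u a)) * (∑[ a < m ] (χ S (x a) * u a))
    form-χ S = trans
      (sum-cong-≗ λ a → trans
        (sum-cong-≗ λ b → regroup (u a) (u b) (χ S (x a)) (χ S (x b)))
        (sym (*-distribˡ-sum (χ S (x a) * u a) (λ b → χ S (x b) * u b))))
      (sym (*-distribʳ-sum _ (λ a → χ S (x a) * u a)))
      where
      regroup : ∀ a b c d → a * b * (c * d) ≡ c * a * (d * b)
      regroup = solve-∀

    -- Only the empty `S` is wanted in the end, but peeling a distance off `D` toggles elements of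
    -- `S`, so the induction must carry a general character.
    twisted : List ℕ → Subset n → Subset n → Subset n → ℤ
    twisted D S p q = χ S p * χ S q * kernel D p q

    -- The correlation is the sum over `i` of the products of singleton characters, and each such
    -- product turns the character of `S` into that of `toggle i S`.
    form-twisted-∷ : ∀ d D S → form (twisted (d ∷ D) S) ≡
      ∑[ i < n ] form (twisted D (toggle i S)) + - (+ (n ∸ 2 ℕ.* d) * form (twisted D S))
    form-twisted-∷ d D S = begin
      form (twisted (d ∷ D) S)
        ≡⟨ form-cong {l = λ p q → correlated p q + scaled p q}
             (λ p q → expand (χ S p * χ S q) (correlation p q) c (kernel D p q)) ⟩
      form (λ p q → correlated p q + scaled p q)
        ≡⟨ form-+ correlated scaled ⟩
      form correlated + form scaled
        ≡⟨ cong₂ _+_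
             (trans (form-cong {k = correlated} toggles) (form-sum (λ i → twisted D (toggle i S))))
             (trans (form-* (- c) (twisted D S)) (sym (ℤ.neg-distribˡ-* c _))) ⟩
      _ ∎
      where
      open ≡-Reasoning
      c = + (n ∸ 2 ℕ.* d)
      correlated scaled : Subset n → Subset n → ℤ
      correlated p q = correlation p q * twisted D S p q
      scaled     p q = - c * twisted D S p q
      expand : ∀ y k c l → y * ((k - c) * l) ≡ k * (y * l) + - c * (y * l)
      expand = solve-∀
      regroup : ∀ a b c d e → a * b * (c * d * e) ≡ a * c * (b * d) * e
      regroup = solve-∀
      toggles : ∀ p q → correlated p q ≡ ∑[ i < n ] twisted D (toggle i S) p q
      toggles p q = trans
        (*-distribʳ-sum (twisted D S p q) (λ i → sign (lookup p i) * sign (lookup q i)))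
        (sum-cong-≗ λ i → trans
          (regroup (sign (lookup p i)) (sign (lookup q i)) (χ S p) (χ S q) (kernel D p q))
          (cong (_* kernel D p q) (sym (cong₂ _*_ (χ-toggle i S p) (χ-toggle i S q)))))

    -- Multiplying by the correlation toggles one element of S, subtracting a
    -- nonnegative constant flips the sign: both shift k by an odd amount.
    form-alternating : ∀ t →
      (∀ S j → ∣ S ∣ ℕ.+ 2 ℕ.* j ≡ t → ∑[ a < m ] (χ S (x a) * u a) ≡ 0ℤ) →
      ∀ D S k → ∣ S ∣ ℕ.+ length D ℕ.+ k ≡ t →
      Alternating k (form (twisted D S))
    -- With no distances left the form is a square. If `k` is even, then `S` is one of the sets
    -- whose character is orthogonal to `u`.
    form-alternating t û≡0 [] S k ∣S∣+k≡t =
      subst (Alternating k)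
        (sym (trans (form-cong λ p q → ℤ.*-identityʳ (χ S p * χ S q)) (form-χ S)))
        (alternating-square k _ λ j 2j≡k → û≡0 S j
          (trans (cong₂ ℕ._+_ (sym (ℕ.+-identityʳ ∣ S ∣)) 2j≡k) ∣S∣+k≡t))
    form-alternating t û≡0 (d ∷ D) S k eq =
      subst (Alternating k) (sym (form-twisted-∷ d D S))
        (alternating-+ k
          (alternating-sum k _ toggled)
          -- `Alternating (suc k)` is `Alternating k` of the negation, which absorbs the minus sign
          -- of the constant term.
          (alternating-* (suc k) (n ∸ 2 ℕ.* d)
            (form-alternating t û≡0 D S (suc k) (trans (shift ∣ S ∣ (length D) k) eq))))
      where
      shift : ∀ s l k → s ℕ.+ l ℕ.+ suc k ≡ s ℕ.+ suc l ℕ.+ k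
      shift s l k = trans (ℕ.+-suc (s ℕ.+ l) k) (cong (ℕ._+ k) (sym (ℕ.+-suc s l)))
      toggled : ∀ i → Alternating k
        (form (twisted D (toggle i S)))
      toggled i with ∣toggle∣ i S
      ... | inj₁ up = form-alternating t û≡0 D (toggle i S) k
        (trans (cong (λ z → z ℕ.+ length D ℕ.+ k) up)
          (trans (cong (ℕ._+ k) (sym (ℕ.+-suc ∣ S ∣ (length D)))) eq))
      -- Here `S` and `D` both lose one element, so the budget `k` grows by 2, which leaves the sign
      -- unchanged.
      ... | inj₂ down = subst (Alternating k) (ℤ.neg-involutive _)
        (form-alternating t û≡0 D (toggle i S) (2 ℕ.+ k)
        (trans (shift ∣ toggle i S ∣ (length D) (suc k))
          (trans (ℕ.+-suc (∣ toggle i S ∣ ℕ.+ suc (length D)) k)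
            (trans (cong (λ z → z ℕ.+ suc (length D) ℕ.+ k) down) eq))))

  -- Bounding a family by the number of characters

  ∣p△p∣≡0 : ∀ {n} (p : Subset n) → ∣ p △ p ∣ ≡ 0
  ∣p△p∣≡0 []          = refl
  ∣p△p∣≡0 (true  ∷ p) = ∣p△p∣≡0 p
  ∣p△p∣≡0 (false ∷ p) = ∣p△p∣≡0 p

  pos-∸ : ∀ {m n} → m ℕ.≤ n → + (n ∸ m) ≡ + n - + m
  pos-∸ {m} {n} m≤n = sym (trans (ℤ.m-n≡m⊖n n m) (ℤ.⊖-≥ m≤n))

  0<i*j : ∀ {i j} → 0ℤ < i → 0ℤ < j → 0ℤ < i * j
  0<i*j {i} {j} 0<i 0<j = subst (_< i * j) (ℤ.*-zeroʳ i) (ℤ.*-monoˡ-<-pos i {{positive 0<i}} 0<j)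

  0≤i*j : ∀ {i j} → 0ℤ ≤ i → 0ℤ ≤ j → 0ℤ ≤ i * j
  0≤i*j {i} {j} 0≤i 0≤j = subst (_≤ i * j) (ℤ.*-zeroʳ i) (ℤ.*-monoˡ-≤-nonNeg i {{nonNegative 0≤i}} 0≤j)

  -- On the diagonal the correlation is `n`, so the factor of each `d` is n - (n - 2d) = 2d.
  kernel-diagonal : ∀ {n} D → All (ℕ._> 0) D → All (λ d → 2 ℕ.* d ℕ.≤ n) D →
                    (p : Subset n) → 0ℤ < kernel D p p
  kernel-diagonal     []      _           _             p = +<+ (s≤s z≤n)
  kernel-diagonal {n} (d ∷ D) (d>0 ∷ D>0) (2d≤n ∷ 2D≤n) p =
    0<i*j (subst (0ℤ <_) (sym factor) (+<+ (ℕ.<-≤-trans d>0 (ℕ.m≤m+n d (d ℕ.+ 0)))))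
          (kernel-diagonal D D>0 2D≤n p)
    where
    factor : correlation p p - + (n ∸ 2 ℕ.* d) ≡ + (2 ℕ.* d)
    factor = begin
      correlation p p - + (n ∸ 2 ℕ.* d)
        ≡⟨ cong₂ _-_ (trans (correlation≡ p p) (trans (cong (λ e → + n - + (2 ℕ.* e)) (∣p△p∣≡0 p))
                       (ℤ.+-identityʳ (+ n)))) (pos-∸ 2d≤n) ⟩
      + n - (+ n - + (2 ℕ.* d))
        ≡⟨ cancel (+ n) (+ (2 ℕ.* d)) ⟩
      + (2 ℕ.* d) ∎
      where
      open ≡-Reasoning
      cancel : ∀ a b → a - (a - b) ≡ b
      cancel = solve-∀

  kernel-vanishes : ∀ {n} {D} → All (λ d → 2 ℕ.* d ℕ.≤ n) D →
                    (p q : Subset n) → ∣ p △ q ∣ ∈ D → kernel D p q ≡ 0ℤ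
  kernel-vanishes {D = d ∷ D} (2d≤n ∷ 2D≤n) p q (here refl) = cong (_* kernel D p q)
    (ℤ.i≡j⇒i-j≡0 (trans (correlation≡ p q) (sym (pos-∸ 2d≤n))))
  kernel-vanishes {n} {d ∷ D} (2d≤n ∷ 2D≤n) p q (there ∈D) =
    trans (cong ((correlation p q - + (n ∸ 2 ℕ.* d)) *_) (kernel-vanishes 2D≤n p q ∈D))
          (ℤ.*-zeroʳ (correlation p q - + (n ∸ 2 ℕ.* d)))

  sum-nonneg : ∀ {m} (f : Fin m → ℤ) → (∀ i → 0ℤ ≤ f i) → 0ℤ ≤ sum f
  sum-nonneg {zero}  f 0≤f = ℤ.≤-refl
  sum-nonneg {suc m} f 0≤f = ℤ.+-mono-≤ (0≤f zero) (sum-nonneg (f ∘ suc) (0≤f ∘ suc))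

  sum-positive : ∀ {m} (f : Fin m → ℤ) → (∀ i → 0ℤ ≤ f i) → ∀ j → 0ℤ < f j → 0ℤ < sum f
  sum-positive {suc m} f 0≤f j 0<fj = subst (0ℤ <_) (sym (sum-remove {i = j} f))
    (ℤ.+-mono-<-≤ 0<fj (sum-nonneg (λ i → f (punchIn j i)) (λ i → 0≤f (punchIn j i))))

  sum-single : ∀ {m} (f : Fin m → ℤ) j → (∀ i → i ≢ j → f i ≡ 0ℤ) → sum f ≡ f j
  sum-single {suc m} f j f≡0 = trans (sum-remove {i = j} f)
    (trans (cong (λ z → f j + z) (sum-zero (λ i → f≡0 (punchIn j i) (punchInᵢ≢i j i))))
           (ℤ.+-identityʳ (f j)))

  i≢0⇒0<i*i : ∀ i → i ≢ 0ℤ → 0ℤ < i * i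
  i≢0⇒0<i*i i i≢0 = ℤ.≤∧≢⇒< (0≤z*z i) λ 0≡i*i →
    [ i≢0 , i≢0 ]′ (ℤ.i*j≡0⇒i≡0∨j≡0 i (sym 0≡i*i))

  χ-⊥ : ∀ {n} (p : Subset n) → χ ⊥ p ≡ 1ℤ
  χ-⊥ []      = refl
  χ-⊥ (b ∷ p) = trans (ℤ.*-identityˡ _) (χ-⊥ p)

  lookup-injective : ∀ {a} {X : Set a} {xs : List X} → Unique xs →
                     ∀ i j → List.lookup xs i ≡ List.lookup xs j → i ≡ j
  lookup-injective (x∉ ∷ xs!) zero    zero    eq = refl
  lookup-injective (x∉ ∷ xs!) zero    (suc j) eq = contradiction eq (All.lookup x∉ (∈-lookup j))
  lookup-injective (x∉ ∷ xs!) (suc i) zero    eq = contradiction (sym eq) (All.lookup x∉ (∈-lookup i))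
  lookup-injective (x∉ ∷ xs!) (suc i) (suc j) eq = cong suc (lookup-injective xs! i j eq)

  -- A vector annihilated by all characters in `E` would give the form two incompatible signs. `E`
  -- may be any list containing the required sets, which keeps the algebra apart from their
  -- enumeration.
  length≤∣characters∣ : ∀ {n} D → All (ℕ._> 0) D → All (λ d → 2 ℕ.* d ℕ.≤ n) D →
    (E : List (Subset n)) → (∀ S j → ∣ S ∣ ℕ.+ 2 ℕ.* j ≡ length D → S ∈ E) →
    (F : List (Subset n)) → HasDistancesIn D F → length F ℕ.≤ length E
  length≤∣characters∣ {n} D D>0 2D≤n E complete F (F! , dist) with length F ℕ.≤? length E
  ... | yes ∣F∣≤∣E∣ = ∣F∣≤∣E∣
  ... | no  ∣F∣≰∣E∣ = contradiction form≤0 (ℤ.<⇒≱ 0<form)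
    where
    m = length F
    x : Fin m → Subset n
    x = List.lookup F

    row : Subset n → Fin m → ℤ
    row S a = χ S (x a)

    -- One equation for each character in `E`, one unknown for each member of `F`.
    solution : Solvable (map row E)
    solution = underdetermined (map row E)
      (subst (ℕ._< m) (sym (length-map row E)) (ℕ.≰⇒> ∣F∣≰∣E∣))
    u = proj₁ solution

    open QuadraticForm x u

    -- For the empty set the budget `k` is 0, and `Alternating 0` is plain nonpositivity.
    form≤0 : form (twisted D ⊥) ≤ 0ℤ
    form≤0 = form-alternating (length D)
      (λ S j eq → All.lookup (All.map⁻ (proj₂ (proj₂ solution))) (complete S j eq))
      D ⊥ 0 (trans (ℕ.+-identityʳ _) (cong (ℕ._+ length D) (∣⊥∣≡0 n)))

    diagonal : Fin m → ℤ
    diagonal a = u a * u a * kernel D (x a) (x a)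

    off-diagonal : ∀ a b → b ≢ a → u a * u b * kernel D (x a) (x b) ≡ 0ℤ
    off-diagonal a b b≢a = trans
      (cong (λ z → u a * u b * z) (kernel-vanishes 2D≤n (x a) (x b)
        (All.lookup (All.lookup dist (∈-lookup a)) (∈-lookup b)
          (λ xₐ≡x_b → b≢a (sym (lookup-injective F! a b xₐ≡x_b))))))
      (ℤ.*-zeroʳ (u a * u b))

    form≡ : form (twisted D ⊥) ≡ ∑[ a < m ] diagonal a
    form≡ = trans
      (form-cong λ p q → trans (cong (_* kernel D p q) (cong₂ _*_ (χ-⊥ p) (χ-⊥ q))) (ℤ.*-identityˡ _))
      (sum-cong-≗ λ a → sum-single (λ b → u a * u b * kernel D (x a) (x b)) a (off-diagonal a))

    0<kernel : ∀ a → 0ℤ < kernel D (x a) (x a)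
    0<kernel a = kernel-diagonal D D>0 2D≤n (x a)

    0<form : 0ℤ < form (twisted D ⊥)
    0<form = let j , uⱼ≢0 = proj₁ (proj₂ solution) in
      subst (0ℤ <_) (sym form≡) (sum-positive diagonal
        (λ a → 0≤i*j (0≤z*z (u a)) (ℤ.<⇒≤ (0<kernel a)))
        j (0<i*j (i≢0⇒0<i*i (u j) uⱼ≢0) (0<kernel j)))

open import Data.List.Base using (sum)
open import Data.Nat.Base
  using (_+_; _*_; _^_; _!; _≤_; _<_; _≥_; _>_; _≤′_; ≤′-refl; ≤′-step)
open import Data.Nat.Combinatorics using (_C_; nC1≡n; nCk+nC[k+1]≡[n+1]C[k+1]; k>n⇒nCk≡0)
open import Data.Nat.Divisibility
open import Data.Nat.ListAction.Properties using (sum-++)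
open import Data.Nat.Properties
open import Data.Nat.Tactic.RingSolver using (solve-∀)
open import Data.Rational.Base using () renaming (_*_ to _*ℚ_)

-- The extremal family

-- The sets S with |S| ≤ t and |S| ≡ t (mod 2).
parityBall : ∀ n → ℕ → List (Subset n)
parityBall zero    zero          = [] ∷ []
-- On the empty ground set only the empty set is available, and it qualifies exactly for even
-- radius.
parityBall zero    (suc zero)    = []
parityBall zero    (suc (suc t)) = parityBall zero t
parityBall (suc n) zero          = map (false ∷_) (parityBall n zero)
parityBall (suc n) (suc t)       =
  map (true ∷_) (parityBall n t) ++ map (false ∷_) (parityBall n (suc t))

-- One equation encodes both the size bound and the parity, with `j` half the slack; this is the
-- completeness that `length≤∣characters∣` asks for.
∈-parityBall⁺ : ∀ {n} t (S : Subset n) j → ∣ S ∣ + 2 * j ≡ t → S ∈ parityBall n t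
∈-parityBall⁺ _ []          zero    refl = here refl
∈-parityBall⁺ _ []          (suc j) refl =
  subst (λ t → [] ∈ parityBall 0 t) (sym (*-suc 2 j)) (∈-parityBall⁺ (2 * j) [] j refl)
∈-parityBall⁺ (suc t) (true  ∷ S) j eq =
  ∈-++⁺ˡ (∈-map⁺ (true ∷_) (∈-parityBall⁺ t S j (suc-injective eq)))
∈-parityBall⁺ zero    (false ∷ S) j eq = ∈-map⁺ (false ∷_) (∈-parityBall⁺ zero S j eq)
∈-parityBall⁺ (suc t) (false ∷ S) j eq =
  ∈-++⁺ʳ (map (true ∷_) (parityBall _ t)) (∈-map⁺ (false ∷_) (∈-parityBall⁺ (suc t) S j eq))

∈-parityBall⁻ : ∀ {n} t {S : Subset n} → S ∈ parityBall n t → ∃ λ j → ∣ S ∣ + 2 * j ≡ t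
∈-parityBall⁻ {zero}  zero          {[]} _  = 0 , refl
∈-parityBall⁻ {zero}  (suc (suc t)) {[]} S∈ with j , refl ← ∈-parityBall⁻ t S∈ = suc j , *-suc 2 j
∈-parityBall⁻ {suc n} zero S∈ with S , S∈′ , refl ← ∈-map⁻ (false ∷_) S∈ = ∈-parityBall⁻ zero S∈′
∈-parityBall⁻ {suc n} (suc t) S∈ with ∈-++⁻ (map (true ∷_) (parityBall n t)) S∈
... | inj₁ S∈ˡ with S , S∈′ , refl ← ∈-map⁻ (true ∷_) S∈ˡ
               with j , eq ← ∈-parityBall⁻ t S∈′ = j , cong suc eq
... | inj₂ S∈ʳ with S , S∈′ , refl ← ∈-map⁻ (false ∷_) S∈ʳ = ∈-parityBall⁻ (suc t) S∈′

parityBall-unique : ∀ n t → Unique (parityBall n t)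
parityBall-unique zero    zero          = [] ∷ []
parityBall-unique zero    (suc zero)    = []
parityBall-unique zero    (suc (suc t)) = parityBall-unique zero t
parityBall-unique (suc n) zero          = Unique.map⁺ ∷-injectiveʳ (parityBall-unique n zero)
parityBall-unique (suc n) (suc t)       =
  Unique.++⁺ (Unique.map⁺ ∷-injectiveʳ (parityBall-unique n t))
             (Unique.map⁺ ∷-injectiveʳ (parityBall-unique n (suc t)))
             λ (p∈ , q∈) → head-differs (proj₂ (proj₂ (∈-map⁻ (true ∷_) p∈)))
                                        (proj₂ (proj₂ (∈-map⁻ (false ∷_) q∈)))
  where
  head-differs : ∀ {p : Subset (suc n)} {q r} → p ≡ true ∷ q → ¬ (p ≡ false ∷ r)
  head-differs refl ()

-- The range is half-open: the sum for i ≤ t is `binomialSum n (suc t)`, and the sum of the odd case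
-- is `binomialSum n t`.
binomialSum : ℕ → ℕ → ℕ
binomialSum n t = sum (map (λ i → n C i) (upTo t))

binomialSum-suc : ∀ n t → binomialSum n (suc t) ≡ binomialSum n t + n C t
binomialSum-suc n t = begin
  sum (map (n C_) (upTo (suc t)))         ≡⟨ cong (sum ∘ map (n C_)) (upTo-∷ʳ t) ⟨
  sum (map (n C_) (upTo t ++ t ∷ []))     ≡⟨ cong sum (map-++ (n C_) (upTo t) (t ∷ [])) ⟩
  sum (map (n C_) (upTo t) ++ n C t ∷ []) ≡⟨ sum-++ (map (n C_) (upTo t)) (n C t ∷ []) ⟩
  binomialSum n t + (n C t + 0)           ≡⟨ cong (binomialSum n t +_) (+-identityʳ (n C t)) ⟩
  binomialSum n t + n C t                 ∎
  where open ≡-Reasoning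

binomialSum-pascal : ∀ n t → binomialSum (suc n) (suc t) ≡ binomialSum n t + binomialSum n (suc t)
binomialSum-pascal n zero    = refl
binomialSum-pascal n (suc t) = begin
  binomialSum (suc n) (suc (suc t))
    ≡⟨ binomialSum-suc (suc n) (suc t) ⟩
  binomialSum (suc n) (suc t) + suc n C suc t
    ≡⟨ cong₂ _+_ (binomialSum-pascal n t) (sym (nCk+nC[k+1]≡[n+1]C[k+1] n t)) ⟩
  (binomialSum n t + binomialSum n (suc t)) + (n C t + n C suc t)
    ≡⟨ interchange (binomialSum n t) (binomialSum n (suc t)) (n C t) (n C suc t) ⟩
  (binomialSum n t + n C t) + (binomialSum n (suc t) + n C suc t)
    ≡⟨ cong₂ _+_ (binomialSum-suc n t) (binomialSum-suc n (suc t)) ⟨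
  binomialSum n (suc t) + binomialSum n (suc (suc t)) ∎
  where
  open ≡-Reasoning
  interchange : ∀ a b c d → (a + b) + (c + d) ≡ (a + c) + (b + d)
  interchange = solve-∀

binomialSum-0 : ∀ t → binomialSum 0 (suc t) ≡ 1
binomialSum-0 zero    = refl
binomialSum-0 (suc t) = trans (binomialSum-suc 0 (suc t))
  (cong₂ _+_ (binomialSum-0 t) (k>n⇒nCk≡0 {0} {suc t} (s≤s z≤n)))

-- Of two consecutive radii exactly one is even.
length-parityBall-0 : ∀ t → length (parityBall 0 t) + length (parityBall 0 (suc t)) ≡ 1
length-parityBall-0 zero    = refl
length-parityBall-0 (suc t) =
  trans (+-comm (length (parityBall 0 (suc t))) (length (parityBall 0 t))) (length-parityBall-0 t)

length-parityBall-suc : ∀ n t → length (parityBall (suc n) (suc t)) ≡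
                        length (parityBall n t) + length (parityBall n (suc t))
length-parityBall-suc n t = trans (length-++ (map (true ∷_) (parityBall n t)))
  (cong₂ _+_ (length-map (true ∷_) (parityBall n t)) (length-map (false ∷_) (parityBall n (suc t))))

-- Both sides obey Pascal's recurrence. The ground set has one point more than the binomials because
-- the parity condition decides the membership of one point.
length-parityBall : ∀ n t → length (parityBall (suc n) t) ≡ binomialSum n (suc t)
length-parityBall zero    zero    = refl
length-parityBall zero    (suc t) = trans (length-parityBall-suc 0 t)
  (trans (length-parityBall-0 t) (sym (binomialSum-0 (suc t))))
length-parityBall (suc n) zero    =
  trans (length-map (false ∷_) (parityBall (suc n) zero)) (length-parityBall n zero)
length-parityBall (suc n) (suc t) = trans (length-parityBall-suc (suc n) t)
  (trans (cong₂ _+_ (length-parityBall n t) (length-parityBall n (suc t)))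
         (sym (binomialSum-pascal n (suc t))))

binomialSum-mono : ∀ n {s t} → s ≤ t → binomialSum n s ≤ binomialSum n t
binomialSum-mono n s≤t = go (≤⇒≤′ s≤t)
  where
  go : ∀ {s t} → s ≤′ t → binomialSum n s ≤ binomialSum n t
  go ≤′-refl             = ≤-refl
  go {t = suc t} (≤′-step s≤′t) = ≤-trans (go s≤′t)
    (≤-trans (m≤m+n _ (n C t)) (≤-reflexive (sym (binomialSum-suc n t))))

-- Ties the parity of a distance to the parities of the two sizes, both for the extremal family and
-- for the parity split.
∣p△q∣+2∣p∩q∣ : ∀ {n} (p q : Subset n) → ∣ p △ q ∣ + 2 * ∣ p ∩ q ∣ ≡ ∣ p ∣ + ∣ q ∣
∣p△q∣+2∣p∩q∣ []          []          = refl
∣p△q∣+2∣p∩q∣ (true  ∷ p) (true  ∷ q) = trans (push ∣ p △ q ∣ ∣ p ∩ q ∣)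
  (trans (cong (2 +_) (∣p△q∣+2∣p∩q∣ p q)) (sym (cong suc (+-suc ∣ p ∣ ∣ q ∣))))
  where
  push : ∀ a b → a + 2 * suc b ≡ 2 + (a + 2 * b)
  push = solve-∀
∣p△q∣+2∣p∩q∣ (true  ∷ p) (false ∷ q) = cong suc (∣p△q∣+2∣p∩q∣ p q)
∣p△q∣+2∣p∩q∣ (false ∷ p) (true  ∷ q) =
  trans (cong suc (∣p△q∣+2∣p∩q∣ p q)) (sym (+-suc ∣ p ∣ ∣ q ∣))
∣p△q∣+2∣p∩q∣ (false ∷ p) (false ∷ q) = ∣p△q∣+2∣p∩q∣ p q

∣p△q∣≡0⇒p≡q : ∀ {n} (p q : Subset n) → ∣ p △ q ∣ ≡ 0 → p ≡ q
∣p△q∣≡0⇒p≡q []          []          _  = refl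
∣p△q∣≡0⇒p≡q (true  ∷ p) (true  ∷ q) eq = cong (true ∷_) (∣p△q∣≡0⇒p≡q p q eq)
∣p△q∣≡0⇒p≡q (false ∷ p) (false ∷ q) eq = cong (false ∷_) (∣p△q∣≡0⇒p≡q p q eq)

∈-D₀ : ∀ t d → 0 < d → 2 ∣ d → d ≤ 2 * t → d ∈ D₀ t
∈-D₀ t _ 0<d (divides (suc e) refl) d≤2t =
  subst (_∈ D₀ t) (*-comm 2 (suc e)) (∈-applyUpTo⁺ (λ i → 2 * suc i)
    (*-cancelˡ-≤ 2 (subst (_≤ 2 * t) (*-comm (suc e) 2) d≤2t)))

-- If |p| + 2i = t and |q| + 2j = t, then the distance is 2t - 2(|p ∩ q| + i + j): even and at most
-- 2t.
parityBall-distances : ∀ n t → HasDistancesIn (D₀ t) (parityBall n t)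
parityBall-distances n t = parityBall-unique n t ,
  All.tabulate λ {p} p∈ → All.tabulate λ {q} q∈ p≢q →
    let i , ∣p∣+2i≡t = ∈-parityBall⁻ t p∈
        j , ∣q∣+2j≡t = ∈-parityBall⁻ t q∈
        sum≡2t : ∣ p △ q ∣ + 2 * (∣ p ∩ q ∣ + i + j) ≡ 2 * t
        sum≡2t = begin
          ∣ p △ q ∣ + 2 * (∣ p ∩ q ∣ + i + j)         ≡⟨ split ∣ p △ q ∣ ∣ p ∩ q ∣ i j ⟩
          ∣ p △ q ∣ + 2 * ∣ p ∩ q ∣ + (2 * i + 2 * j) ≡⟨ cong (_+ (2 * i + 2 * j)) (∣p△q∣+2∣p∩q∣ p q) ⟩
          ∣ p ∣ + ∣ q ∣ + (2 * i + 2 * j)             ≡⟨ interchange ∣ p ∣ ∣ q ∣ (2 * i) (2 * j) ⟩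
          (∣ p ∣ + 2 * i) + (∣ q ∣ + 2 * j)           ≡⟨ cong₂ _+_ ∣p∣+2i≡t
                                                            (trans ∣q∣+2j≡t (sym (+-identityʳ t))) ⟩
          2 * t                                       ∎
    in ∈-D₀ t ∣ p △ q ∣ (n≢0⇒n>0 (p≢q ∘ ∣p△q∣≡0⇒p≡q p q))
         (∣m+n∣m⇒∣n (subst (2 ∣_) (trans (sym sum≡2t) (+-comm ∣ p △ q ∣ _)) (m∣m*n t))
                    (m∣m*n (∣ p ∩ q ∣ + i + j)))
         (m+n≤o⇒m≤o ∣ p △ q ∣ (≤-reflexive sum≡2t))
  where
  open ≡-Reasoning
  split : ∀ a b c d → a + 2 * (b + c + d) ≡ a + 2 * b + (2 * c + 2 * d)
  split = solve-∀
  interchange : ∀ a b c d → (a + b) + (c + d) ≡ (a + c) + (b + d)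
  interchange = solve-∀

-- Bounds on A

A≤binomialSum : ∀ n D → All (_> 0) D → All (λ d → 2 * d ≤ suc n) D →
                A (suc n) D ≤ binomialSum n (suc (length D))
A≤binomialSum n D D>0 2D≤n = let F , F-dist , ∣F∣≡A = A-attained (suc n) D in begin
  A (suc n) D                               ≡⟨ ∣F∣≡A ⟨
  length F                                  ≤⟨ length≤∣characters∣ D D>0 2D≤n (parityBall (suc n) (length D))
                                                 (∈-parityBall⁺ (length D)) F F-dist ⟩
  length (parityBall (suc n) (length D))    ≡⟨ length-parityBall n (length D) ⟩
  binomialSum n (suc (length D))            ∎
  where open ≤-Reasoning

binomialSum≤A-D₀ : ∀ n t → binomialSum n (suc t) ≤ A (suc n) (D₀ t)
binomialSum≤A-D₀ n t = subst (_≤ A (suc n) (D₀ t)) (length-parityBall n t)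
  (A-upper (suc n) (D₀ t) (parityBall (suc n) t) (parityBall-distances (suc n) t))

-- The largest distance in `D₀ t` is 2t, whence the threshold 4t.
A-D₀ : ∀ n t → 2 * (2 * t) ≤ suc n → A (suc n) (D₀ t) ≡ binomialSum n (suc t)
A-D₀ n t 4t≤n = ≤-antisym
  (subst (λ l → A (suc n) (D₀ t) ≤ binomialSum n (suc l)) (length-applyUpTo (λ i → 2 * suc i) t)
    (A≤binomialSum n (D₀ t)
      (All.applyUpTo⁺₁ (λ i → 2 * suc i) t (λ _ → s≤s z≤n))
      (All.applyUpTo⁺₁ (λ i → 2 * suc i) t (λ i<t → ≤-trans (*-monoʳ-≤ 2 (*-monoʳ-≤ 2 i<t)) 4t≤n))))
  (binomialSum≤A-D₀ n t)

-- Splitting a family by the parity of sizes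

length-filter-¬ : ∀ {a p} {X : Set a} {P : Pred X p} (P? : Decidable P) xs →
                  length xs ≡ length (filter P? xs) + length (filter (¬? ∘ P?) xs)
length-filter-¬ P? []       = refl
length-filter-¬ P? (x ∷ xs) with P? x
... | yes _ = cong suc (length-filter-¬ P? xs)
... | no  _ = trans (cong suc (length-filter-¬ P? xs)) (sym (+-suc _ _))

2∣n⊎2∣1+n : ∀ n → (2 ∣ n) ⊎ (2 ∣ suc n)
2∣n⊎2∣1+n zero    = inj₁ (2 ∣0)
2∣n⊎2∣1+n (suc n) with 2∣n⊎2∣1+n n
... | inj₁ 2∣n   = inj₂ (∣m∣n⇒∣m+n ∣-refl 2∣n)
... | inj₂ 2∣1+n = inj₁ 2∣1+n

odd+odd : ∀ {m n} → ¬ (2 ∣ m) → ¬ (2 ∣ n) → 2 ∣ (m + n)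
odd+odd {m} {n} 2∤m 2∤n with 2∣n⊎2∣1+n m | 2∣n⊎2∣1+n n
... | inj₁ 2∣m | _        = contradiction 2∣m 2∤m
... | inj₂ _   | inj₁ 2∣n = contradiction 2∣n 2∤n
... | inj₂ 2∣1+m | inj₂ 2∣1+n =
  ∣m+n∣m⇒∣n (subst (2 ∣_) (cong suc (+-suc m n)) (∣m∣n⇒∣m+n 2∣1+m 2∣1+n)) ∣-refl

evenPart : List ℕ → List ℕ
evenPart = filter (2 ∣?_)

-- Asking only that any two sizes have even sum lets one lemma serve both the even and the odd
-- class.
filter-distances-even : ∀ {n p} {P : Pred (Subset n) p} (P? : Decidable P) →
  (∀ {p q} → P p → P q → 2 ∣ (∣ p ∣ + ∣ q ∣)) →
  ∀ D F → HasDistancesIn D F → HasDistancesIn (evenPart D) (filter P? F)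
filter-distances-even P? even D F (F! , dist) = Unique.filter⁺ P? F! ,
  All.tabulate λ {p} p∈ → All.tabulate λ {q} q∈ p≢q →
    let p∈F , Pp = ∈-filter⁻ P? p∈
        q∈F , Pq = ∈-filter⁻ P? q∈
    in ∈-filter⁺ (2 ∣?_) (All.lookup (All.lookup dist p∈F) q∈F p≢q)
         (∣m+n∣m⇒∣n (subst (2 ∣_) (trans (sym (∣p△q∣+2∣p∩q∣ p q)) (+-comm ∣ p △ q ∣ _)) (even Pp Pq))
                    (m∣m*n ∣ p ∩ q ∣))

-- Sets whose sizes have the same parity are at even distance.
A≤2*A-evenPart : ∀ n D → A n D ≤ 2 * A n (evenPart D)
A≤2*A-evenPart n D = let F , F-dist , ∣F∣≡A = A-attained n D in begin
  A n D
    ≡⟨ ∣F∣≡A ⟨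
  length F
    ≡⟨ length-filter-¬ even? F ⟩
  length (filter even? F) + length (filter (¬? ∘ even?) F)
    ≤⟨ +-mono-≤
         (A-upper n (evenPart D) _ (filter-distances-even even? ∣m∣n⇒∣m+n D F F-dist))
         (A-upper n (evenPart D) _ (filter-distances-even (¬? ∘ even?) odd+odd D F F-dist)) ⟩
  A n (evenPart D) + A n (evenPart D)
    ≡⟨ cong (A n (evenPart D) +_) (+-identityʳ _) ⟨
  2 * A n (evenPart D) ∎
  where
  open ≤-Reasoning
  even? : Decidable (λ (p : Subset n) → 2 ∣ ∣ p ∣)
  even? p = 2 ∣? ∣ p ∣

A≤2*binomialSum : ∀ n D → All (_> 0) D → All (λ d → 2 * d ≤ suc n) D → Any (λ d → ¬ (2 ∣ d)) D →
                  A (suc n) D ≤ 2 * binomialSum n (length D)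
A≤2*binomialSum n D D>0 2D≤n odd∈D = ≤-trans (A≤2*A-evenPart (suc n) D) (*-monoʳ-≤ 2
  (≤-trans (A≤binomialSum n (evenPart D) (All.filter⁺ (2 ∣?_) D>0) (All.filter⁺ (2 ∣?_) 2D≤n))
           -- Discarding an odd distance shortens the list, and this pays for the `suc` in the index
           -- of `A≤binomialSum`.
           (binomialSum-mono n (filter-notAll (2 ∣?_) D odd∈D))))

-- Binomial estimates

-- The identity (k+1) C(n,k+1) = (n-k) C(n,k), in additive form so that it also holds for k > n
-- without truncation.
[k+1]nC[k+1]+knCk≡nnCk : ∀ n k → suc k * (n C suc k) + k * (n C k) ≡ n * (n C k)
[k+1]nC[k+1]+knCk≡nnCk zero    zero    = refl
[k+1]nC[k+1]+knCk≡nnCk zero    (suc k) = cong₂ _+_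
  (trans (cong (suc (suc k) *_) (k>n⇒nCk≡0 {0} {suc (suc k)} (s≤s z≤n))) (*-zeroʳ (suc (suc k))))
  (trans (cong (suc k *_) (k>n⇒nCk≡0 {0} {suc k} (s≤s z≤n))) (*-zeroʳ (suc k)))
[k+1]nC[k+1]+knCk≡nnCk (suc n) zero    =
  trans (+-identityʳ _) (trans (*-identityˡ _) (trans (nC1≡n (suc n)) (sym (*-identityʳ (suc n)))))
[k+1]nC[k+1]+knCk≡nnCk (suc n) (suc k) = begin
  suc (suc k) * (suc n C suc (suc k)) + suc k * (suc n C suc k)
    ≡⟨ cong₂ (λ x y → suc (suc k) * x + suc k * y)
         (nCk+nC[k+1]≡[n+1]C[k+1] n (suc k)) (nCk+nC[k+1]≡[n+1]C[k+1] n k) ⟨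
  suc (suc k) * (b + c) + suc k * (a + b)
    ≡⟨ regroup k a b c ⟩
  (suc (suc k) * c + suc k * b) + (suc k * b + k * a) + (a + b)
    ≡⟨ cong₂ (λ x y → x + y + (a + b)) ([k+1]nC[k+1]+knCk≡nnCk n (suc k)) ([k+1]nC[k+1]+knCk≡nnCk n k) ⟩
  n * b + n * a + (a + b)
    ≡⟨ collect n a b ⟩
  suc n * (a + b)
    ≡⟨ cong (suc n *_) (nCk+nC[k+1]≡[n+1]C[k+1] n k) ⟩
  suc n * (suc n C suc k) ∎
  where
  open ≡-Reasoning
  a = n C k
  b = n C suc k
  c = n C suc (suc k)
  regroup : ∀ k a b c → suc (suc k) * (b + c) + suc k * (a + b) ≡
                        (suc (suc k) * c + suc k * b) + (suc k * b + k * a) + (a + b)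
  regroup = solve-∀
  collect : ∀ n a b → n * b + n * a + (a + b) ≡ suc n * (a + b)
  collect = solve-∀

-- The product n(n-1)...(n-t+1), expressed through the binomial coefficient that is to be estimated.
fallingFactorial : ℕ → ℕ → ℕ
fallingFactorial n t = t ! * (n C t)

fallingFactorial-suc : ∀ n t → fallingFactorial n (suc t) + t * fallingFactorial n t ≡
                       n * fallingFactorial n t
fallingFactorial-suc n t = begin
  suc t * t ! * (n C suc t) + t * (t ! * (n C t))
    ≡⟨ factor (suc t) (t !) (n C suc t) t (n C t) ⟩
  t ! * (suc t * (n C suc t) + t * (n C t))
    ≡⟨ cong (t ! *_) ([k+1]nC[k+1]+knCk≡nnCk n t) ⟩
  t ! * (n * (n C t))
    ≡⟨ swap (t !) n (n C t) ⟩
  n * (t ! * (n C t)) ∎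
  where
  open ≡-Reasoning
  factor : ∀ s f c t d → s * f * c + t * (f * d) ≡ f * (s * c + t * d)
  factor = solve-∀
  swap : ∀ a b c → a * (b * c) ≡ b * (a * c)
  swap = solve-∀

fallingFactorial≤^ : ∀ n t → fallingFactorial n t ≤ n ^ t
fallingFactorial≤^ n zero    = ≤-refl
fallingFactorial≤^ n (suc t) = begin
  fallingFactorial n (suc t)                              ≤⟨ m≤m+n _ _ ⟩
  fallingFactorial n (suc t) + t * fallingFactorial n t   ≡⟨ fallingFactorial-suc n t ⟩
  n * fallingFactorial n t                                ≤⟨ *-monoʳ-≤ n (fallingFactorial≤^ n t) ⟩
  n * n ^ t                                               ∎
  where open ≤-Reasoning

nCk≤n^k : ∀ n k → n C k ≤ n ^ k
nCk≤n^k n k = ≤-trans (m≤n*m (n C k) (k !) {{k !≢0}}) (fallingFactorial≤^ n k)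

triangular : ℕ → ℕ
triangular zero    = 0
triangular (suc t) = suc t + triangular t

-- The factors of the falling factorial fall short of `m` by 1, ..., t. Replacing them by `m` costs
-- at most 1 + ... + t times m^(t-1); everything is multiplied by `m` to avoid the exponent t - 1.
^≤fallingFactorial : ∀ n t → let m = suc n in
  m * m ^ t ≤ m * fallingFactorial n t + triangular t * m ^ t
^≤fallingFactorial n zero    = m≤m+n _ 0
^≤fallingFactorial n (suc t) = begin
  m * (m * m ^ t)
    ≤⟨ *-monoʳ-≤ m (^≤fallingFactorial n t) ⟩
  m * (m * f t + triangular t * m ^ t)
    ≡⟨ regroup n (f t) (triangular t) (m ^ t) ⟩
  m * (n * f t + f t) + triangular t * (m * m ^ t)
    ≡⟨ cong (λ z → m * (z + f t) + triangular t * (m * m ^ t)) (fallingFactorial-suc n t) ⟨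
  m * (f (suc t) + t * f t + f t) + triangular t * (m * m ^ t)
    ≡⟨ split n (f (suc t)) t (f t) (triangular t * (m * m ^ t)) ⟩
  -- The next factor n - t falls short of `m` by t + 1, which becomes the new summand of
  -- `triangular`.
  m * f (suc t) + suc t * (m * f t) + triangular t * (m * m ^ t)
    ≤⟨ +-monoˡ-≤ _ (+-monoʳ-≤ (m * f (suc t)) (*-monoʳ-≤ (suc t) (*-monoʳ-≤ m
         (≤-trans (fallingFactorial≤^ n t) (^-monoˡ-≤ t (n≤1+n n)))))) ⟩
  m * f (suc t) + suc t * (m * m ^ t) + triangular t * (m * m ^ t)
    ≡⟨ collect (m * f (suc t)) (suc t) (triangular t) (m * m ^ t) ⟩
  m * f (suc t) + triangular (suc t) * (m * m ^ t) ∎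
  where
  open ≤-Reasoning
  m = suc n
  f = fallingFactorial n
  regroup : ∀ n g c e → suc n * (suc n * g + c * e) ≡ suc n * (n * g + g) + c * (suc n * e)
  regroup = solve-∀
  split : ∀ n g′ t g r → suc n * (g′ + t * g + g) + r ≡ suc n * g′ + suc t * (suc n * g) + r
  split = solve-∀
  collect : ∀ a s c e → a + s * e + c * e ≡ a + (s + c) * e
  collect = solve-∀

-- Each of the `t` binomials has lower index below `t`, so `m` times it is at most `m ^ t`.
n*binomialSum≤ : ∀ n t → suc n * binomialSum n t ≤ t * suc n ^ t
n*binomialSum≤ n zero    = ≤-reflexive (*-zeroʳ (suc n))
n*binomialSum≤ n (suc t) = begin
  m * binomialSum n (suc t)         ≡⟨ cong (m *_) (binomialSum-suc n t) ⟩
  m * (binomialSum n t + n C t)     ≡⟨ *-distribˡ-+ m (binomialSum n t) (n C t) ⟩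
  m * binomialSum n t + m * (n C t) ≤⟨ +-mono-≤ (n*binomialSum≤ n t)
                                         (*-monoʳ-≤ m (≤-trans (nCk≤n^k n t) (^-monoˡ-≤ t (n≤1+n n)))) ⟩
  t * m ^ t + m * m ^ t             ≤⟨ +-monoˡ-≤ (m * m ^ t) (*-monoʳ-≤ t (m≤n*m (m ^ t) m)) ⟩
  t * (m * m ^ t) + m * m ^ t       ≡⟨ +-comm (t * (m * m ^ t)) (m * m ^ t) ⟩
  suc t * m ^ suc t                 ∎
  where
  open ≤-Reasoning
  m = suc n

-- The top binomial alone already suffices for the lower bound.
^≤t!binomialSum : ∀ n t → let m = suc n in
  m * m ^ t ≤ m * (t ! * binomialSum n (suc t)) + triangular t * m ^ t
^≤t!binomialSum n t = ≤-trans (^≤fallingFactorial n t)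
  (+-monoˡ-≤ _ (*-monoʳ-≤ (suc n) (*-monoʳ-≤ (t !)
    (≤-trans (m≤n+m (n C t) (binomialSum n t)) (≤-reflexive (sym (binomialSum-suc n t)))))))

-- The top binomial yields the main term; the `t` lower ones go into the error.
t!binomialSum≤^ : ∀ n t → let m = suc n in
  m * (t ! * binomialSum n (suc t)) ≤ m * m ^ t + t ! * t * m ^ t
t!binomialSum≤^ n t = begin
  m * (t ! * binomialSum n (suc t))
    ≡⟨ cong (λ z → m * (t ! * z)) (binomialSum-suc n t) ⟩
  m * (t ! * (binomialSum n t + n C t))
    ≡⟨ regroup m (t !) (binomialSum n t) (n C t) ⟩
  m * fallingFactorial n t + t ! * (m * binomialSum n t)
    ≤⟨ +-mono-≤ (*-monoʳ-≤ m (≤-trans (fallingFactorial≤^ n t) (^-monoˡ-≤ t (n≤1+n n))))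
                (*-monoʳ-≤ (t !) (n*binomialSum≤ n t)) ⟩
  m * m ^ t + t ! * (t * m ^ t)
    ≡⟨ cong (m * m ^ t +_) (*-assoc (t !) t (m ^ t)) ⟨
  m * m ^ t + t ! * t * m ^ t ∎
  where
  open ≤-Reasoning
  m = suc n
  regroup : ∀ m f b c → m * (f * (b + c)) ≡ m * (f * c) + f * (m * b)
  regroup = solve-∀

-- Thresholds for large `n` and the assembled statement

all-2d≤n : ∀ D {n} → 2 * max 0 D ≤ n → All (λ d → 2 * d ≤ n) D
all-2d≤n D 2max≤n = All.map (λ d≤max → ≤-trans (*-monoʳ-≤ 2 d≤max) 2max≤n) (xs≤max 0 D)

open import Data.Integer.Base using (+_)

corollary4p4 : (t : ℕ) → t ≥ 1 →
    (D : List ℕ) → Unique D → All (_> 0) D → length D ≡ t →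
    Eventually (λ n →
    A n D ≤ A n (D₀ t) ×
    A n (D₀ t) ≡ sum (map (λ i → (n ∸ 1) C i) (upTo (suc t)))) ×
    (Any (λ d → ¬ (2 ∣ d)) D →
    Eventually (λ n →
    A n D ≤ 2 * sum (map (λ i → (n ∸ 1) C i) (upTo t)))) ×
    (λ n → fromℕ (2 * sum (map (λ i → (n ∸ 1) C i) (upTo t)))) =o (λ n → fromℕ (n ^ t)) ×
    (λ n → fromℕ (A n (D₀ t))) ~ (λ n → ((+ 1) / (t !)) {{t !≢0}} *ℚ fromℕ (n ^ t))
corollary4p4 t _ D _ D>0 refl =
  -- The thresholds for `D` and for `D₀ t` are added, so each follows from the sum; the leading
  -- `suc` excludes n = 0, making `n ∸ 1` a true predecessor.
  (suc (2 * max 0 D + 2 * (2 * t)) , λ { (suc n) (s≤s N≤n) →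
    let 2max≤n = m≤n⇒m≤1+n (m+n≤o⇒m≤o (2 * max 0 D) N≤n)
        4t≤n   = m≤n⇒m≤1+n (m+n≤o⇒n≤o (2 * max 0 D) N≤n)
    in ≤-trans (A≤binomialSum n D D>0 (all-2d≤n D 2max≤n)) (binomialSum≤A-D₀ n t)
     , A-D₀ n t 4t≤n }) ,
  (λ odd∈D → suc (2 * max 0 D) , λ { (suc n) (s≤s 2max≤n) →
    A≤2*binomialSum n D D>0 (all-2d≤n D (m≤n⇒m≤1+n 2max≤n)) odd∈D }) ,
  -- The constant is twice the one in `n*binomialSum≤`.
  fromℕ-=o (λ n → 2 * binomialSum (n ∸ 1) t) (_^ t) (2 * t) (1 , λ { (suc n) _ →
    ≤-trans (≤-reflexive (x*2y (suc n) (binomialSum n t)))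
      (≤-trans (*-monoʳ-≤ 2 (n*binomialSum≤ n t)) (≤-reflexive (sym (*-assoc 2 t (suc n ^ t))))) }) ,
  -- `t ! * t` bounds the excess from the lower binomials and `triangular t` the deficit of the top
  -- one; their sum serves both directions.
  fromℕ-~ (λ n → A n (D₀ t)) (_^ t) (t !) {{t !≢0}} (t ! * t + triangular t)
    (suc (2 * (2 * t)) , λ { (suc n) (s≤s 4t≤n) →
    let m   = suc n
        A≡s = sym (A-D₀ n t (m≤n⇒m≤1+n 4t≤n))
    in subst (λ a → m * (t ! * a) ≤ m * m ^ t + (t ! * t + triangular t) * m ^ t) A≡s
         (≤-trans (t!binomialSum≤^ n t) (+-monoʳ-≤ (m * m ^ t)
           (*-monoˡ-≤ (m ^ t) (m≤m+n (t ! * t) (triangular t)))))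
     , subst (λ a → m * m ^ t ≤ m * (t ! * a) + (t ! * t + triangular t) * m ^ t) A≡s
         (≤-trans (^≤t!binomialSum n t) (+-monoʳ-≤ (m * (t ! * binomialSum n (suc t)))
           (*-monoˡ-≤ (m ^ t) (m≤n+m (triangular t) (t ! * t))))) })
  where
  x*2y : ∀ x y → x * (2 * y) ≡ 2 * (x * y)
  x*2y = solve-∀
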